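{- Let $U$ be an infinite binary information system from the class $W_1^l$. Then: (a) The system $U$ is $ld$-reachable. (b) The system $U$ is not $la$-reachable, and there exists $m\in\mathbb{N}$ such that $(m,\,(m+1)L_U^{la}(n)/2+1)$ (i.e. the pair of functions $\varphi(n)=m$, $\psi(n)=(m+1)L_U^{la}(n)/2+1$) is a boundary $la$-pair of the system $U$.
   Context: $\mathbb{N}=\{1,2,\ldots\}$. An infinite binary information system is a pair $U=(A,F)$ where $A$ is an infinite set (of objects) and $F$ is an infinite set of functions $A\to\{0,1\}$ (attributes). A problem over $U$ is a tuple $z=(\nu,f_1,\ldots,f_n)$ with $n\in\mathbb{N}$, $\nu:\{0,1\}^n\to\mathbb{N}$ and $f_1,\ldots,f_n\in F$ (not necessarily distinct); $z(a)=\nu(f_1(a),\ldots,f_n(a))$ for $a\in A$, and $\dim z=n$. Decision trees. A decision tree over $U$ is a finite directed rooted tree in which the root and the edges leaving the root are unlabeled, each terminal node is labeled with a number from $\mathbb{N}$, each working node (neither the root nor terminal) is labeled with an attribute from $F$, and each edge leaving a working node is labeled with a number from $\{0,1\}$ (the root is not terminal; several edges leaving the same working node may carry the same label). It is deterministic if exactly one edge leaves the root and edges leaving any working node have different labels. A complete path $\xi$ is a directed path from the root to a terminal node; $A(\xi)$ is the set of all $a\in A$ such that, for each working node of $\xi$, labeled with attribute $f$ and followed in $\xi$ by an edge labeled $\delta$, one has $f(a)=\delta$ ($A(\xi)=A$ if $\xi$ has no working nodes). The depth $h(\Gamma)$ is the maximum number of working nodes in a complete path of $\Gamma$; $L(\Gamma)$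 is the number of all nodes of $\Gamma$, including the root. $\Gamma$ is a decision tree over the problem $z=(\nu,f_1,\ldots,f_n)$ if all its working nodes are labeled with attributes from $\{f_1,\ldots,f_n\}$. A decision tree $\Gamma$ over $z$ solves $z$ nondeterministically if for every $a\in A$ there is a complete path $\xi$ with $a\in A(\xi)$, and for every $a\in A$ and every complete path $\xi$ with $a\in A(\xi)$ the terminal node of $\xi$ is labeled $z(a)$. It solves $z$ deterministically if, in addition, $\Gamma$ is deterministic. Complexity functions. $h_U^{ld}(z)$ and $L_U^{ld}(z)$ (resp. $h_U^{la}(z)$ and $L_U^{la}(z)$) are the minimum depth and the minimum number of nodes of a decision tree over $z$ solving $z$ deterministically (resp. nondeterministically). For $n\in\mathbb{N}$, $h_U^{ld}(n)$, $h_U^{la}(n)$, $L_U^{ld}(n)$, $L_U^{la}(n)$ are the maxima of $h_U^{ld}(z)$, $h_U^{la}(z)$, $L_U^{ld}(z)$, $L_U^{la}(z)$, respectively, over all problems $z$ over $U$ with $\dim z\le n$. I-dimension. A finite set $\{f_1,\ldots,f_m\}\subseteq F$ (of cardinality $m$) is independent if for all $\delta_1,\ldots,\delta_m\in\{0,1\}$ the system $\{f_1(x)=\delta_1,\ldots,f_m(x)=\delta_m\}$ has a solution in $A$; the empty set is independent. $I(U)=\infty$ if $F$ contains independent subsets of every cardinality $m\in\mathbb{N}$; otherwise $I(U)$ is the maximum cardinality of an independent subset of $F$. Class $W_1^l$: all infinite binary information systems $U$ of local type (LOG, CON, POL, POL), i.e. such that $h_U^{ld}(n)=\Theta(\log n)$,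 $h_U^{la}(n)=O(1)$, $I(U)<\infty$, and $2(n+1)\le L(n)\le 2(4n)^{I(U)}$ for all $n\in\mathbb{N}$, for both $L=L_U^{ld}$ and $L=L_U^{la}$. Boundary pairs and reachability. A pair $(\varphi,\psi)$ of functions $\mathbb{N}\to\mathbb{N}\cup\{0\}$ is a boundary $ld$-pair (resp. boundary $la$-pair) of $U$ if for every problem $z$ over $U$ there is a decision tree $\Gamma$ over $z$ which solves $z$ deterministically (resp. nondeterministically) with $h(\Gamma)\le\varphi(n)$ and $L(\Gamma)\le\psi(n)$, where $n=\dim z$. $U$ is $ld$-reachable if $(h_U^{ld},L_U^{ld})$ is a boundary $ld$-pair of $U$, and $la$-reachable if $(h_U^{la},L_U^{la})$ is a boundary $la$-pair of $U$. -}

module Defs where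

open import Axiom.ExcludedMiddle using (ExcludedMiddle)
open import Data.Bool.Base using (Bool; true; false)
open import Data.Empty using (⊥-elim)
open import Data.Fin.Base using (Fin; zero; suc)
open import Data.Irrelevant using ([_])
open import Data.List.Base using (List; [])
open import Data.List.Membership.Propositional using (_∈_)
import Data.List.Relation.Unary.Any as List
open import Data.Nat.Base
open import Data.Nat.Logarithm using (⌊log₂_⌋)
open import Data.Nat.Properties
open import Data.Product.Base using (∃; ∃-syntax; Σ-syntax; _×_; _,_; proj₁; proj₂)
open import Data.Refinement.Base using (Refinement-syntax; _,_; value)
open import Data.Sum.Base using (_⊎_; inj₁; inj₂)
open import Data.Unit.Polymorphic.Base using (⊤; tt)
open import Data.Vec.Base using (Vec; []; _∷_; map; replicate)
import Data.Vec.Functional as Vector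
open import Data.Vec.Relation.Unary.Any using (Any; here; there)
open import Function.Base using (_∘_)
open import Function.Definitions using (Injective)
open import Level using (Level; 0ℓ) renaming (suc to lsuc)
open import Relation.Binary.PropositionalEquality
open import Relation.Nullary using (¬_; yes; no)
open import Relation.Unary using (Pred)

private
  variable
    ℓ : Level

ℕ⁺ : Set
ℕ⁺ = [ n ∈ ℕ ∣ NonZero n ]

IsMinimum : Pred ℕ ℓ → Pred ℕ ℓ
IsMinimum P k = P k × (∀ j → P j → k ≤ j)

IsMaximum : Pred ℕ ℓ → Pred ℕ ℓ
IsMaximum P k = P k × (∀ j → P j → j ≤ k)

minimum : ExcludedMiddle ℓ → (P : Pred ℕ ℓ) → ∃ P → ∃ (IsMinimum P)
minimum em P (k , pk) with search k
  where
  search : ∀ n → ∃ (IsMinimum P) ⊎ (∀ j → P j → n ≤ j)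
  search zero = inj₂ (λ _ _ → z≤n)
  search (suc n) with search n
  ... | inj₁ found = inj₁ found
  ... | inj₂ above with em {P n}
  ...   | yes pn = inj₁ (n , pn , above)
  ...   | no ¬pn = inj₂ λ j pj →
            ≤∧≢⇒< (above j pj) (λ n≡j → ¬pn (subst P (sym n≡j) pj))
... | inj₁ found = found
... | inj₂ above = k , pk , above

maximum : ExcludedMiddle ℓ → (P : Pred ℕ ℓ) → ∃ P →
          (b : ℕ) → (∀ j → P j → j ≤ b) → ∃ (IsMaximum P)
maximum em P (k , pk) zero    below = k , pk , λ j pj → ≤-trans (below j pj) z≤n
maximum em P nonempty (suc b) below with em {P (suc b)}
... | yes pb = suc b , pb , below
... | no ¬pb = maximum em P nonempty b λ j pj →
        s≤s⁻¹ (≤∧≢⇒< (below j pj) (λ j≡b → ¬pb (subst P j≡b pj)))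

infix 4 _=O_ _=Θ_

-- Natural constants suffice: real ones may be rounded up.
_=O_ : (ℕ⁺ → ℕ) → (ℕ⁺ → ℕ) → Set
f =O g = ∃[ c ] ∃[ n₀ ] ∀ n → n₀ ≤ value n → f n ≤ c * g n

_=Θ_ : (ℕ⁺ → ℕ) → (ℕ⁺ → ℕ) → Set
f =Θ g = f =O g × g =O f

-- ⌊log₂ n⌋ ≤ log₂ n ≤ 2 ⌊log₂ n⌋ for n ≥ 2, so rounding does not
-- affect Θ(log n).
log : ℕ⁺ → ℕ
log n = ⌊log₂ value n ⌋

-- Attributes are compared pointwise, as elements of a set of functions.
record InfiniteBinaryInformationSystem (ℓ : Level) : Set (lsuc ℓ) where
  field
    Object             : Set ℓ
    IsAttribute        : Pred (Object → Bool) ℓ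
    objects-infinite    : ¬ (∃[ xs ] ∀ (a : Object) → a ∈ xs)
    attributes-infinite : ¬ (Σ[ fs ∈ List (Object → Bool) ]
                             ∀ f → IsAttribute f → List.Any (f ≗_) fs)

  Attribute : Set ℓ
  Attribute = ∃ IsAttribute

  infix 4 _≈_

  _≈_ : Attribute → Attribute → Set ℓ
  f ≈ g = proj₁ f ≗ proj₁ g

module _ (U : InfiniteBinaryInformationSystem ℓ) where

  open InfiniteBinaryInformationSystem U

  record Problem : Set ℓ where
    field
      dim        : ℕ⁺
      ν          : Vec Bool (value dim) → ℕ⁺
      attributes : Vec Attribute (value dim)

    solution : Object → ℕ⁺
    solution a = ν (map (λ f → proj₁ f a) attributes)

  open Problem

  Independent : ∀ {m} → (Fin m → Attribute) → Set ℓ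
  Independent {m} f = (δ : Fin m → Bool) → ∃[ a ] ∀ i → proj₁ (f i) a ≡ δ i

  HasIndependentSubset : Pred ℕ ℓ
  HasIndependentSubset m =
    Σ[ f ∈ (Fin m → Attribute) ] (Injective _≡_ _≈_ f × Independent f)

  -- IsIDimension d says that I(U) is finite and equal to d.
  IsIDimension : Pred ℕ ℓ
  IsIDimension = IsMaximum HasIndependentSubset

  -- A terminal or working node with everything below it.  A working
  -- node has k + 1 outgoing edges, the i-th one labelled δ i and leading
  -- to t i.
  data Node : Set ℓ where
    terminal : ℕ⁺ → Node
    working  : (f : Attribute) (k : ℕ) (δ : Fin (suc k) → Bool)
               (t : Fin (suc k) → Node) → Node

  record DecisionTree : Set ℓ where
    constructor root
    field
      k : ℕ
      t : Fin (suc k) → Node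

  DeterministicNode : Node → Set ℓ
  DeterministicNode (terminal _)      = ⊤
  DeterministicNode (working f k δ t) =
    Injective _≡_ _≡_ δ × (∀ i → DeterministicNode (t i))

  Deterministic : DecisionTree → Set ℓ
  Deterministic (root k t) = suc k ≡ 1 × (∀ i → DeterministicNode (t i))

  data Path : Node → Set ℓ where
    stop : ∀ {r} → Path (terminal r)
    step : ∀ {f k δ t} (i : Fin (suc k)) → Path (t i) → Path (working f k δ t)

  CompletePath : DecisionTree → Set ℓ
  CompletePath (root k t) = ∃[ i ] Path (t i)

  pathLength : ∀ {v} → Path v → ℕ
  pathLength stop       = 0
  pathLength (step _ p) = suc (pathLength p)

  pathLabel : ∀ {v} → Path v → ℕ⁺
  pathLabel (stop {r}) = r
  pathLabel (step _ p) = pathLabel p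

  pathObjects : ∀ {v} → Path v → Pred Object 0ℓ
  pathObjects stop                   a = ⊤
  pathObjects (step {f} {δ = δ} i p) a = proj₁ f a ≡ δ i × pathObjects p a

  workingNodes : ∀ Γ → CompletePath Γ → ℕ
  workingNodes _ (_ , p) = pathLength p

  terminalLabel : ∀ Γ → CompletePath Γ → ℕ⁺
  terminalLabel _ (_ , p) = pathLabel p

  -- The set written A(ξ).
  objects : ∀ Γ → CompletePath Γ → Pred Object 0ℓ
  objects _ (_ , p) = pathObjects p

  nodeDepth : Node → ℕ
  nodeDepth (terminal _)      = 0
  nodeDepth (working f k δ t) = suc (Vector.foldr _⊔_ 0 (nodeDepth ∘ t))

  depth : DecisionTree → ℕ
  depth (root k t) = Vector.foldr _⊔_ 0 (nodeDepth ∘ t)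

  nodeSize : Node → ℕ
  nodeSize (terminal _)      = 1
  nodeSize (working f k δ t) = suc (Vector.foldr _+_ 0 (nodeSize ∘ t))

  size : DecisionTree → ℕ
  size (root k t) = suc (Vector.foldr _+_ 0 (nodeSize ∘ t))

  private
    ≤-max : ∀ {n} (x : Fin n → ℕ) i → x i ≤ Vector.foldr _⊔_ 0 x
    ≤-max x zero    = m≤m⊔n _ _
    ≤-max x (suc i) = ≤-trans (≤-max (x ∘ suc) i) (m≤n⊔m (x zero) _)

    max-attained : ∀ {n} (x : Fin (suc n) → ℕ) → ∃[ i ] x i ≡ Vector.foldr _⊔_ 0 x
    max-attained {zero}  x = zero , sym (⊔-identityʳ _)
    max-attained {suc n} x with max-attained (x ∘ suc) | ⊔-sel (x zero) (Vector.foldr _⊔_ 0 (x ∘ suc))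
    ... | _      | inj₁ eq = zero , sym eq
    ... | i , xi | inj₂ eq = suc i , trans xi (sym eq)

    longest : ∀ v → ∃[ p ] pathLength {v} p ≡ nodeDepth v
    longest (terminal _)      = stop , refl
    longest (working f k δ t) with max-attained (nodeDepth ∘ t)
    ... | i , eq with longest (t i)
    ...   | p , eq′ = step i p , cong suc (trans eq′ eq)

    bounded : ∀ {v} (p : Path v) → pathLength p ≤ nodeDepth v
    bounded stop                   = z≤n
    bounded (step {t = t} i p) = s≤s (≤-trans (bounded p) (≤-max (nodeDepth ∘ t) i))

  depth-isMaximum : ∀ Γ → IsMaximum (λ d → ∃[ ξ ] workingNodes Γ ξ ≡ d) (depth Γ)
  depth-isMaximum (root k t) with max-attained (nodeDepth ∘ t)
  ... | i , eq with longest (t i)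
  ...   | p , eq′ = ((i , p) , trans eq′ eq) , λ where
            _ ((j , q) , refl) → ≤-trans (bounded q) (≤-max (nodeDepth ∘ t) j)

  NodeOver : Problem → Node → Set ℓ
  NodeOver z (terminal _)      = ⊤
  NodeOver z (working f k δ t) = Any (f ≈_) (attributes z) × (∀ i → NodeOver z (t i))

  infix 4 _Over_

  _Over_ : DecisionTree → Problem → Set ℓ
  root k t Over z = ∀ i → NodeOver z (t i)

  SolvesNondeterministically : DecisionTree → Problem → Set ℓ
  SolvesNondeterministically Γ z =
    (∀ a → ∃[ ξ ] objects Γ ξ a) ×
    (∀ a ξ → objects Γ ξ a → terminalLabel Γ ξ ≡ solution z a)

  SolvesDeterministically : DecisionTree → Problem → Set ℓ
  SolvesDeterministically Γ z = Deterministic Γ × SolvesNondeterministically Γ z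

data Kind : Set where
  ld la : Kind

module _ (U : InfiniteBinaryInformationSystem ℓ) where

  open InfiniteBinaryInformationSystem U
  open Problem

  Solves : Kind → DecisionTree U → Problem U → Set ℓ
  Solves ld = SolvesDeterministically U
  Solves la = SolvesNondeterministically U

  Cost : (DecisionTree U → ℕ) → Kind → Problem U → Pred ℕ ℓ
  Cost μ κ z c = ∃[ Γ ] (_Over_ U Γ z × Solves κ Γ z × μ Γ ≡ c)

  -- The tree querying all attributes of a problem in turn shows that the
  -- minima and maxima below exist.
  private
    edge : Fin 2 → Bool
    edge zero       = false
    edge (suc zero) = true

    full : ∀ {n} → Vec Attribute n → (Vec Bool n → ℕ⁺) → Node U
    full []       g = terminal (g [])
    full (f ∷ fs) g = working f 1 edge (λ i → full fs (g ∘ (edge i ∷_)))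

    edge-injective : Injective _≡_ _≡_ edge
    edge-injective {zero}     {zero}     _ = refl
    edge-injective {zero}     {suc zero} ()
    edge-injective {suc zero} {zero}     ()
    edge-injective {suc zero} {suc zero} _ = refl

    full-deterministic : ∀ {n} (fs : Vec Attribute n) g → DeterministicNode U (full fs g)
    full-deterministic []       g = tt
    full-deterministic (f ∷ fs) g = edge-injective , λ i → full-deterministic fs _

    full-over : ∀ z {n} (fs : Vec Attribute n) g →
                (∀ f → Any (f ≈_) fs → Any (f ≈_) (attributes z)) →
                NodeOver U z (full fs g)
    full-over z []       g sub = tt
    full-over z (f ∷ fs) g sub =
      sub f (here λ _ → refl) , λ i → full-over z fs _ (λ f m → sub f (there m))

    full-path : ∀ {n} (fs : Vec Attribute n) g a → ∃[ p ] pathObjects U {full fs g} p a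
    full-path []       g a = stop , tt
    full-path (f ∷ fs) g a with proj₁ f a in eq
    ... | false = let p , q = full-path fs _ a in step zero p , eq , q
    ... | true  = let p , q = full-path fs _ a in step (suc zero) p , eq , q

    full-label : ∀ {n} (fs : Vec Attribute n) g a p → pathObjects U {full fs g} p a →
                 pathLabel U p ≡ g (map (λ f → proj₁ f a) fs)
    full-label []       g a stop       _        = refl
    full-label (f ∷ fs) g a (step i p) (eq , q) rewrite eq = full-label fs _ a p q

    full-depth : ∀ {n} (fs : Vec Attribute n) g → nodeDepth U (full fs g) ≡ n
    full-depth []       g = refl
    full-depth {suc n} (f ∷ fs) g
      rewrite full-depth fs (g ∘ (false ∷_)) | full-depth fs (g ∘ (true ∷_))
      = cong suc (trans (cong (n ⊔_) (⊔-identityʳ n)) (⊔-idem n))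

    full-size : ∀ {n} (fs : Vec Attribute n) g → suc (nodeSize U (full fs g)) ≡ 2 ^ suc n
    full-size []       g = refl
    full-size {suc n} (f ∷ fs) g = begin
      suc (suc (s₀ + (s₁ + 0)))         ≡⟨ cong (λ x → suc (suc (s₀ + x))) (+-identityʳ s₁) ⟩
      suc (suc (s₀ + s₁))               ≡⟨ cong suc (+-suc s₀ s₁) ⟨
      suc s₀ + suc s₁                   ≡⟨ cong₂ _+_ (full-size fs _) (full-size fs _) ⟩
      2 ^ suc n + 2 ^ suc n             ≡⟨ cong (2 ^ suc n +_) (+-identityʳ _) ⟨
      2 ^ suc (suc n)                   ∎
      where
      open ≡-Reasoning
      s₀ = nodeSize U (full fs (g ∘ (false ∷_)))
      s₁ = nodeSize U (full fs (g ∘ (true ∷_)))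

    fullTree : Problem U → DecisionTree U
    fullTree z = root 0 (λ _ → full (attributes z) (ν z))

    fullTree-over : ∀ z → _Over_ U (fullTree z) z
    fullTree-over z _ = full-over z (attributes z) (ν z) (λ _ m → m)

    fullTree-solves : ∀ κ z → Solves κ (fullTree z) z
    fullTree-solves la z =
      (λ a → let p , q = full-path (attributes z) (ν z) a in (zero , p) , q) ,
      (λ a (_ , p) q → full-label (attributes z) (ν z) a p q)
    fullTree-solves ld z =
      (refl , λ _ → full-deterministic (attributes z) (ν z)) , fullTree-solves la z

    fullTree-depth : ∀ z → depth U (fullTree z) ≡ value (dim z)
    fullTree-depth z = trans (⊔-identityʳ _) (full-depth (attributes z) (ν z))

    fullTree-size : ∀ z → size U (fullTree z) ≡ 2 ^ suc (value (dim z))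
    fullTree-size z =
      trans (cong suc (+-identityʳ _)) (full-size (attributes z) (ν z))

  cost-exists : ∀ μ κ z → ∃ (Cost μ κ z)
  cost-exists μ κ z = _ , fullTree z , fullTree-over z , fullTree-solves κ z , refl

  -- Selecting these minima and maxima is not computable, hence excluded
  -- middle.
  module _ (em : ExcludedMiddle ℓ) where

    private
      someAttribute : Attribute
      someAttribute with em {Attribute}
      ... | yes f = f
      ... | no ¬f = ⊥-elim (attributes-infinite ([] , λ f f∈F → ⊥-elim (¬f (f , f∈F))))

      someProblem : ℕ⁺ → Problem U
      someProblem n = record
        { dim = n ; ν = λ _ → 1 , [ _ ] ; attributes = replicate _ someAttribute }

    minimumCost : ∀ μ κ z → ∃ (IsMinimum (Cost μ κ z))
    minimumCost μ κ z = minimum em (Cost μ κ z) (cost-exists μ κ z)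

    WorstCost : (DecisionTree U → ℕ) → Kind → ℕ⁺ → Pred ℕ ℓ
    WorstCost μ κ n c =
      ∃[ z ] (value (dim z) ≤ value n × proj₁ (minimumCost μ κ z) ≡ c)

    private
      worstCost : ∀ μ κ (b : ℕ → ℕ) → (∀ {m n} → m ≤ n → b m ≤ b n) →
                  (∀ z → μ (fullTree z) ≡ b (value (dim z))) →
                  ∀ n → ∃ (IsMaximum (WorstCost μ κ n))
      worstCost μ κ b mono eq n =
        maximum em (WorstCost μ κ n)
          (_ , someProblem n , ≤-refl , refl) (b (value n)) λ where
            _ (z , d≤n , refl) →
              ≤-trans (proj₂ (proj₂ (minimumCost μ κ z)) _
                        (fullTree z , fullTree-over z , fullTree-solves κ z , refl))
                      (≤-trans (≤-reflexive (eq z)) (mono d≤n))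

    worstDepth : ∀ κ n → ∃ (IsMaximum (WorstCost (depth U) κ n))
    worstDepth κ = worstCost (depth U) κ (λ n → n) (λ m≤n → m≤n) fullTree-depth

    worstSize : ∀ κ n → ∃ (IsMaximum (WorstCost (size U) κ n))
    worstSize κ =
      worstCost (size U) κ (λ n → 2 ^ suc n) (λ m≤n → ^-monoʳ-≤ 2 (s≤s m≤n)) fullTree-size

    h L : Kind → ℕ⁺ → ℕ
    h κ n = proj₁ (worstDepth κ n)
    L κ n = proj₁ (worstSize κ n)

    record W₁ˡ : Set ℓ where
      field
        h-ld         : h ld =Θ log
        h-la         : h la =O (λ _ → 1)
        I            : ℕ
        isIDimension : IsIDimension U I
        L-lower      : ∀ κ n → 2 * (value n + 1) ≤ L κ n
        L-upper      : ∀ κ n → L κ n ≤ 2 * (4 * value n) ^ I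

  BoundaryPair : Kind → (φ ψ : ℕ⁺ → ℕ) → Set ℓ
  BoundaryPair κ φ ψ =
    ∀ z → ∃[ Γ ] (_Over_ U Γ z × Solves κ Γ z ×
                  depth U Γ ≤ φ (dim z) × size U Γ ≤ ψ (dim z))

  Reachable : ExcludedMiddle ℓ → Kind → Set ℓ
  Reachable em κ = BoundaryPair κ (h em κ) (L em κ)

-- For a problem z let N be the number of tuples (f₁(a), …, fₙ(a)), a ∈ A.  A
-- deterministic tree can be pruned, without increasing its depth, until every
-- working node splits the set of tuples reaching it, and then it has at most
-- 2N nodes.  Conversely let ν be injective.  In a nondeterministic tree,
-- two edges with the same label leaving a node help only if neither of the
-- subtrees below them covers everything that reaches it, and such subtrees
-- cost at least two nodes per covered tuple; so the tree has at least 2N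
-- nodes, and if exactly 2N, then it branches like a deterministic one and
-- N ≤ 2^depth.  Hence L(n) is twice the maximum of N for both kinds of trees,
-- which gives (a).  If U were la-reachable, the attributes maximising N would
-- yield n + 1 ≤ N ≤ 2^c with c bounding h(n), for all n.  For the boundary
-- pair, one keeps a single path of a shallow tree for each of the N tuples.

module Submission where

open import Defs
open import Axiom.ExcludedMiddle using (ExcludedMiddle)
open import Data.Nat using (_+_; _*_; _/_)
open import Data.Nat.Divisibility using (_∣_)
open import Data.Product using (_×_; Σ-syntax)
open import Data.Refinement using (value)
open import Relation.Nullary using (¬_)

open import Data.Bool.Base using (Bool; true; false; if_then_else_)
open import Data.Bool.Properties using (_≟_)
open import Data.Empty using (⊥-elim)
open import Data.Fin.Base using (Fin; zero; suc)
open import Data.Irrelevant using ([_])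
open import Data.List.Base as List using (List; []; _∷_; length; lookup)
open import Data.List.Membership.Propositional using (_∈_; find)
open import Data.List.Membership.Propositional.Properties
  using (∈-++⁺ˡ; ∈-++⁺ʳ; ∈-map⁺)
open import Data.List.Relation.Unary.All as All using (All; []; _∷_)
open import Data.List.Relation.Unary.All.Properties using (¬Any⇒All¬)
open import Data.List.Relation.Unary.AllPairs as AllPairs using (AllPairs; []; _∷_)
open import Data.List.Relation.Unary.Any as Any using (Any; here; there)
open import Data.List.Relation.Unary.Any.Properties using (lookup-index)
open import Data.Nat.Base
  using (ℕ; zero; suc; _≤_; _<_; _⊔_; _^_; z≤n; s≤s)
open import Data.Nat.DivMod using (m*n/n≡m)
open import Data.Nat.Divisibility using (divides)
open import Data.Nat.ListAction using (sum)
open import Data.Nat.Properties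
  using ( +-commutativeSemigroup; ≤-refl; ≤-trans; ≤-reflexive; +-mono-≤; +-identityʳ; +-suc
        ; +-comm; *-distribˡ-+; *-monoʳ-≤; *-monoˡ-≤; *-cancelˡ-≡; *-cancelˡ-≤; *-identityʳ
        ; ^-monoʳ-≤; m≤m+n; m≤n+m; n≤1+n; m≤m⊔n; m≤n⊔m; ⊔-lub; ⊔-identityʳ; ⊔-mono-≤
        ; <⇒≱; even≢odd; suc-injective; module ≤-Reasoning)
open import Algebra.Properties.CommutativeSemigroup +-commutativeSemigroup
  using () renaming (interchange to +-interchange)
open import Data.Nat.Solver using (module +-*-Solver)
open import Data.Product using (∃-syntax; _,_; proj₁; proj₂)
open import Data.Refinement using (_,_)
open import Data.Sum.Base using (_⊎_; inj₁; inj₂; [_,_]′)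
open import Data.Unit.Polymorphic.Base using (⊤; tt)
open import Data.Vec.Base as Vec using (Vec; []; _∷_)
import Data.Vec.Functional as Vector
open import Data.Vec.Properties using (∷-injective)
import Data.Vec.Relation.Unary.Any as VecAny
open import Function.Base using (_∘_; id; case_of_)
open import Function.Definitions using (Injective)
open import Level using (Level)
open import Relation.Binary.PropositionalEquality
open import Relation.Nullary using (Dec; yes; no; does)
open import Relation.Unary using (Pred; _∩_)

private
  variable
    ℓ : Level

-- Finite sums and maxima, and bit vectors.

sumᶠ maxᶠ : ∀ {n} → (Fin n → ℕ) → ℕ
sumᶠ = Vector.foldr _+_ 0
maxᶠ = Vector.foldr _⊔_ 0

≤-maxᶠ : ∀ {n} (x : Fin n → ℕ) i → x i ≤ maxᶠ x
≤-maxᶠ x zero    = m≤m⊔n _ _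
≤-maxᶠ x (suc i) = ≤-trans (≤-maxᶠ (x ∘ suc) i) (m≤n⊔m (x zero) _)

maxᶠ-lub : ∀ {n b} (x : Fin n → ℕ) → (∀ i → x i ≤ b) → maxᶠ x ≤ b
maxᶠ-lub {zero}  x x≤b = z≤n
maxᶠ-lub {suc n} x x≤b = ⊔-lub (x≤b zero) (maxᶠ-lub (x ∘ suc) (x≤b ∘ suc))

sumᶠ-≤ : ∀ {n b} (x : Fin n → ℕ) → (∀ i → x i ≤ b) → sumᶠ x ≤ n * b
sumᶠ-≤ {zero}  x x≤b = z≤n
sumᶠ-≤ {suc n} x x≤b = +-mono-≤ (x≤b zero) (sumᶠ-≤ (x ∘ suc) (x≤b ∘ suc))

-- Entries whose edge carries the other label become 0 instead of being removed, so that both halves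
-- of the family keep the index set `Fin n`.
labelled : ∀ {n} → (Fin n → Bool) → Bool → (Fin n → ℕ) → Fin n → ℕ
labelled δ b x i = if does (δ i ≟ b) then x i else 0

labelled-sum : ∀ {n} (δ : Fin n → Bool) (x : Fin n → ℕ) →
  sumᶠ (labelled δ false x) + sumᶠ (labelled δ true x) ≡ sumᶠ x
labelled-sum {zero}  δ x = refl
labelled-sum {suc n} δ x = trans
  (+-interchange (labelled δ false x zero) _ (labelled δ true x zero) _)
  (cong₂ _+_ head (labelled-sum (δ ∘ suc) (x ∘ suc)))
  where
  head : labelled δ false x zero + labelled δ true x zero ≡ x zero
  head with δ zero
  ... | false = +-identityʳ _
  ... | true  = refl

bitVectors : ∀ n → List (Vec Bool n)
bitVectors zero    = [] ∷ []
bitVectors (suc n) =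
  List.map (false ∷_) (bitVectors n) List.++ List.map (true ∷_) (bitVectors n)

∈-bitVectors : ∀ {n} (v : Vec Bool n) → v ∈ bitVectors n
∈-bitVectors []          = here refl
∈-bitVectors (false ∷ v) = ∈-++⁺ˡ (∈-map⁺ (false ∷_) (∈-bitVectors v))
∈-bitVectors {suc n} (true ∷ v) =
  ∈-++⁺ʳ (List.map (false ∷_) (bitVectors n)) (∈-map⁺ (true ∷_) (∈-bitVectors v))

binary : ∀ {n} → Vec Bool n → ℕ
binary []          = 0
binary (false ∷ v) = 2 * binary v
binary (true ∷ v)  = suc (2 * binary v)

-- Parity determines the first bit, and halving leaves the number of the remaining vector.
binary-injective : ∀ {n} (v w : Vec Bool n) → binary v ≡ binary w → v ≡ w
binary-injective [] [] _ = refl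
binary-injective (false ∷ v) (false ∷ w) eq =
  cong (false ∷_) (binary-injective v w (*-cancelˡ-≡ (binary v) (binary w) 2 eq))
binary-injective (false ∷ v) (true ∷ w) eq = ⊥-elim (even≢odd (binary v) (binary w) eq)
binary-injective (true ∷ v) (false ∷ w) eq = ⊥-elim (even≢odd (binary w) (binary v) (sym eq))
binary-injective (true ∷ v) (true ∷ w) eq =
  cong (true ∷_)
    (binary-injective v w (*-cancelˡ-≡ (binary v) (binary w) 2 (suc-injective eq)))

-- Counting list entries with an undecided property.

module Counting (em : ExcludedMiddle ℓ) {A : Set ℓ} where

  indicator : Set ℓ → ℕ
  indicator P = if does (em {P}) then 1 else 0

  count : Pred A ℓ → List A → ℕ
  count P xs = sum (List.map (indicator ∘ P) xs)

  private
    variable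
      P Q R : Pred A ℓ

  count-⊎ : (∀ x → P x → Q x ⊎ R x) → ∀ xs → count P xs ≤ count Q xs + count R xs
  count-⊎ P⊆Q∪R [] = z≤n
  count-⊎ {P} {Q} {R} P⊆Q∪R (x ∷ xs) =
    ≤-trans (+-mono-≤ head (count-⊎ P⊆Q∪R xs))
            (≤-reflexive (+-interchange (indicator (Q x)) _ _ _))
    where
    head : indicator (P x) ≤ indicator (Q x) + indicator (R x)
    head with em {P x} | em {Q x} | em {R x}
    ... | no _  | _     | _     = z≤n
    ... | yes _ | yes _ | _     = s≤s z≤n
    ... | yes _ | no _  | yes _ = ≤-refl
    ... | yes p | no ¬q | no ¬r = ⊥-elim ([ ¬q , ¬r ]′ (P⊆Q∪R x p))

  count-disjoint : (∀ x → Q x → P x) → (∀ x → R x → P x) → (∀ x → Q x → ¬ R x) →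
                   ∀ xs → count Q xs + count R xs ≤ count P xs
  count-disjoint Q⊆P R⊆P disjoint [] = z≤n
  count-disjoint {Q} {P} {R} Q⊆P R⊆P disjoint (x ∷ xs) =
    ≤-trans (≤-reflexive (+-interchange (indicator (Q x)) _ _ _))
            (+-mono-≤ head (count-disjoint Q⊆P R⊆P disjoint xs))
    where
    head : indicator (Q x) + indicator (R x) ≤ indicator (P x)
    head with em {P x} | em {Q x} | em {R x}
    ... | _     | no _  | no _  = z≤n
    ... | _     | yes q | yes r = ⊥-elim (disjoint x q r)
    ... | yes _ | yes _ | no _  = ≤-refl
    ... | yes _ | no _  | yes _ = ≤-refl
    ... | no ¬p | yes q | no _  = ⊥-elim (¬p (Q⊆P x q))
    ... | no ¬p | no _  | yes r = ⊥-elim (¬p (R⊆P x r))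

  count-mono : (∀ x → P x → Q x) → ∀ xs → count P xs ≤ count Q xs
  count-mono P⊆Q [] = z≤n
  count-mono {P} {Q} P⊆Q (x ∷ xs) = +-mono-≤ head (count-mono P⊆Q xs)
    where
    head : indicator (P x) ≤ indicator (Q x)
    head with em {P x} | em {Q x}
    ... | no _  | _     = z≤n
    ... | yes _ | yes _ = ≤-refl
    ... | yes p | no ¬q = ⊥-elim (¬q (P⊆Q x p))

  count-none : ∀ xs → All (¬_ ∘ P) xs → count P xs ≡ 0
  count-none [] [] = refl
  count-none {P} (x ∷ xs) (¬p ∷ ¬ps) with em {P x}
  ... | yes p = ⊥-elim (¬p p)
  ... | no _  = count-none xs ¬ps

  count-some : ∀ {x xs} → x ∈ xs → P x → 1 ≤ count P xs
  count-some {P} {x} (here refl) p with em {P x}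
  ... | yes _ = s≤s z≤n
  ... | no ¬p = ⊥-elim (¬p p)
  count-some (there x∈xs) p = ≤-trans (count-some x∈xs p) (m≤n+m _ _)

  Everything : Pred A ℓ
  Everything _ = ⊤

  length≤count : ∀ xs → length xs ≤ count Everything xs
  length≤count [] = z≤n
  length≤count (x ∷ xs) = +-mono-≤ one (length≤count xs)
    where
    one : 1 ≤ indicator ⊤
    one with em {⊤}
    ... | yes _  = ≤-refl
    ... | no ¬tt = ⊥-elim (¬tt tt)

  -- Two entries satisfying `P` would share the value `y`, against the distinctness of the values of
  -- `f` along the list.
  count-constant : ∀ {b} {B : Set b} (f : A → B) {y} → (∀ x → P x → f x ≡ y) →
                   ∀ {xs} → AllPairs (λ x x′ → f x ≢ f x′) xs → count P xs ≤ 1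
  count-constant f const [] = z≤n
  count-constant {P} f const {x ∷ xs} (x# ∷ distinct) with em {P x}
  ... | no _  = count-constant f const distinct
  ... | yes p = s≤s (≤-reflexive (count-none xs
    (All.map (λ fx≢fx′ p′ → fx≢fx′ (trans (const _ p) (sym (const _ p′)))) x#)))

  -- Runs through the possible values and adds a preimage of `y` only if its value is not yet
  -- represented. Thus `ys` may contain repetitions and values that are never taken.
  representatives : ∀ {B : Set} (f : A → B) (ys : List B) → (∀ x → f x ∈ ys) →
    ∃[ xs ] (AllPairs (λ x x′ → f x ≢ f x′) xs × (∀ x → Any (λ x′ → f x ≡ f x′) xs))
  representatives {B} f ys f∈ys = let xs , distinct , complete = go ys in
    xs , distinct , λ x → complete x (f∈ys x)
    where
    go : (ys : List B) →
      ∃[ xs ] (AllPairs (λ x x′ → f x ≢ f x′) xs ×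
               (∀ x → f x ∈ ys → Any (λ x′ → f x ≡ f x′) xs))
    go [] = [] , [] , λ _ ()
    go (y ∷ ys) with go ys
    ... | xs , distinct , complete
      with em {∃[ x ] (f x ≡ y × All (λ x′ → f x ≢ f x′) xs)}
    ... | yes (x , fx≡y , x#) = x ∷ xs , x# ∷ distinct , λ where
      x′ (here fx′≡y)  → here (trans fx′≡y (sym fx≡y))
      x′ (there fx′∈ys) → there (complete x′ fx′∈ys)
    ... | no none = xs , distinct , λ where
      x′ (there fx′∈ys) → complete x′ fx′∈ys
      x′ (here fx′≡y)  → case em {Any (λ x → f x′ ≡ f x) xs} of λ where
        (yes found) → found
        (no ¬found) → ⊥-elim (none (x′ , fx′≡y , ¬Any⇒All¬ xs ¬found))

-- Tuples of attribute values and their representatives.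

module _ (em : ExcludedMiddle ℓ) (U : InfiniteBinaryInformationSystem ℓ) where

  open InfiniteBinaryInformationSystem U
  open Counting em {Object}
  open Problem

  tuple : (z : Problem U) → Object → Vec Bool (value (dim z))
  tuple z a = Vec.map (λ f → proj₁ f a) (attributes z)

  Separated : (z : Problem U) → List Object → Set ℓ
  Separated z = AllPairs (λ a b → tuple z a ≢ tuple z b)

  -- Correctness localised to one subtree and one object, so that it can be established on
  -- representatives first.
  SolvesAt : Problem U → Node U → Pred Object ℓ
  SolvesAt z v a =
    (∃[ p ] pathObjects U {v} p a) ×
    (∀ p → pathObjects U {v} p a → pathLabel U p ≡ solution z a)

  attribute-≡ : ∀ {n} (fs : Vec Attribute n) f a b →
    Vec.map (λ f → proj₁ f a) fs ≡ Vec.map (λ f → proj₁ f b) fs →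
    VecAny.Any (f ≈_) fs → proj₁ f a ≡ proj₁ f b
  attribute-≡ (g ∷ fs) f a b eq (VecAny.here f≈g) =
    trans (f≈g a) (trans (proj₁ (∷-injective eq)) (sym (f≈g b)))
  attribute-≡ (g ∷ fs) f a b eq (VecAny.there f∈fs) =
    attribute-≡ fs f a b (proj₂ (∷-injective eq)) f∈fs

  -- A tree over `z` queries only attributes of `z`, so it cannot tell apart objects with the same
  -- tuple.
  pathObjects-≡ : ∀ z {v} → NodeOver U z v → ∀ {a b} → tuple z a ≡ tuple z b →
    (p : Path U v) → pathObjects U p a → pathObjects U p b
  pathObjects-≡ z over eq stop _ = tt
  pathObjects-≡ z (f∈z , over) {a} {b} eq (step {f} i p) (fa≡δ , a∈p) =
    trans (sym (attribute-≡ (attributes z) f a b eq f∈z)) fa≡δ ,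
    pathObjects-≡ z (over i) eq p a∈p

  solvesAt-≡ : ∀ z {v} → NodeOver U z v → ∀ {a b} → tuple z a ≡ tuple z b →
    SolvesAt z v b → SolvesAt z v a
  solvesAt-≡ z over eq ((p , b∈p) , label) =
    (p , pathObjects-≡ z over (sym eq) p b∈p) , λ q a∈q →
      trans (label q (pathObjects-≡ z over eq q a∈q)) (cong (ν z) (sym eq))

  module _ (z : Problem U) where

    private
      reps = representatives (tuple z) (bitVectors _) (λ a → ∈-bitVectors (tuple z a))

    realized : List Object
    realized = proj₁ reps

    realized-separated : Separated z realized
    realized-separated = proj₁ (proj₂ reps)

    realized-complete : ∀ a → Any (λ b → tuple z a ≡ tuple z b) realized
    realized-complete = proj₂ (proj₂ reps)

    -- The number of realized tuples, written as a count to match the bounds below, which are stated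
    -- for `count S xs`.
    N : ℕ
    N = count Everything realized

  -- Pruning deterministic trees.

  module Pruning (z : Problem U) (xs : List Object) where

    private
      edge : Fin 2 → Bool
      edge zero       = false
      edge (suc zero) = true

      edge-injective : Injective _≡_ _≡_ edge
      edge-injective {zero}     {zero}     _ = refl
      edge-injective {zero}     {suc zero} ()
      edge-injective {suc zero} {zero}     ()
      edge-injective {suc zero} {suc zero} _ = refl

    Occupied : Pred Object ℓ → Set ℓ
    Occupied S = ∃[ a ] (a ∈ xs × S a)

    -- Here `S` is the set of objects reaching the node. A binary tree with l leaves has 2l - 1
    -- nodes, and each leaf is to hold a listed object of its own; this is the source of `size<`.
    -- The node left over there later pays for the root.
    record Pruned (d : ℕ) (S : Pred Object ℓ) : Set ℓ where
      field
        node          : Node U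
        deterministic : DeterministicNode U node
        over          : NodeOver U z node
        depth≤        : nodeDepth U node ≤ d
        size<         : suc (nodeSize U node) ≤ 2 * count S xs
        solves        : ∀ {a} → a ∈ xs → S a → SolvesAt z node a

    open Pruned

    restrict : ∀ {d S b} (f : Attribute) → (∀ {a} → a ∈ xs → S a → proj₁ f a ≡ b) →
      Pruned d (λ a → S a × proj₁ f a ≡ b) → Pruned (suc d) S
    restrict f fS≡b v = record
      { Pruned v
      ; depth≤ = ≤-trans (depth≤ v) (n≤1+n _)
      ; size<  = ≤-trans (size< v) (*-monoʳ-≤ 2 (count-mono (λ _ → proj₁) xs))
      ; solves = λ a∈xs s → solves v a∈xs (s , fS≡b a∈xs s)
      }

    -- The size plus one is additive over the two subtrees, and the two answers to `f` select
    -- disjoint parts of `S`.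
    branch : ∀ {d S} (f : Attribute) → VecAny.Any (f ≈_) (attributes z) →
      (∀ b → Pruned d (λ a → S a × proj₁ f a ≡ b)) → Pruned (suc d) S
    branch {d} {S} f f∈z v = record
      { node          = working f 1 edge (node ∘ v ∘ edge)
      ; deterministic = edge-injective , λ i → deterministic (v (edge i))
      ; over          = f∈z , λ i → over (v (edge i))
      ; depth≤        = s≤s (maxᶠ-lub (nodeDepth U ∘ node ∘ v ∘ edge)
                               (λ i → depth≤ (v (edge i))))
      ; size<         = size-bound
      ; solves        = λ a∈xs s → covers a∈xs s , λ where
          (step i p) (fa≡ , a∈p) → proj₂ (solves (v (edge i)) a∈xs (s , fa≡)) p a∈p
      }
      where
      covers : ∀ {a} → a ∈ xs → S a → ∃[ p ] pathObjects U {working f 1 edge (node ∘ v ∘ edge)} p a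
      covers {a} a∈xs s with proj₁ f a in fa≡
      ... | false = let p , a∈p = proj₁ (solves (v false) a∈xs (s , fa≡)) in
                    step zero p , fa≡ , a∈p
      ... | true  = let p , a∈p = proj₁ (solves (v true) a∈xs (s , fa≡)) in
                    step (suc zero) p , fa≡ , a∈p

      s₀ = nodeSize U (node (v false))
      s₁ = nodeSize U (node (v true))

      size-bound : suc (suc (s₀ + (s₁ + 0))) ≤ 2 * count S xs
      size-bound = begin
        suc (suc (s₀ + (s₁ + 0))) ≡⟨ cong (λ s → suc (suc (s₀ + s))) (+-identityʳ s₁) ⟩
        suc (suc (s₀ + s₁))       ≡⟨ cong suc (+-suc s₀ s₁) ⟨
        suc s₀ + suc s₁           ≤⟨ +-mono-≤ (size< (v false)) (size< (v true)) ⟩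
        2 * count _ xs + 2 * count _ xs ≡⟨ *-distribˡ-+ 2 (count _ xs) _ ⟨
        2 * (count _ xs + count _ xs)
          ≤⟨ *-monoʳ-≤ 2 (count-disjoint (λ _ → proj₁) (λ _ → proj₁)
               (λ _ (_ , f≡false) (_ , f≡true) → case trans (sym f≡false) f≡true of λ ()) xs) ⟩
        2 * count S xs            ∎
        where open ≤-Reasoning

    -- A query is kept only if both answers occur among the listed objects of `S`; otherwise the one
    -- subtree that is used takes its place. Every leaf is therefore occupied, which pays for it in
    -- `size<`.
    prune : ∀ v → DeterministicNode U v → NodeOver U z v → ∀ {S} → Occupied S →
      (∀ {a} → a ∈ xs → S a → SolvesAt z v a) → Pruned (nodeDepth U v) S
    prune (terminal r) _ _ (a , a∈xs , s) solved = record
      { node          = terminal r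
      ; deterministic = tt
      ; over          = tt
      ; depth≤        = z≤n
      ; size<         = *-monoʳ-≤ 2 (count-some a∈xs s)
      ; solves        = solved
      }
    prune (working f k δ t) (δ-injective , det) (f∈z , ov) {S} (a , a∈xs , s) solved =
      choose (em {Occupied (S′ false)}) (em {Occupied (S′ true)})
      where
      S′ : Bool → Pred Object ℓ
      S′ b a = S a × proj₁ f a ≡ b

      side : ∀ b → Occupied (S′ b) → Pruned (maxᶠ (nodeDepth U ∘ t)) (S′ b)
      side b (a , a∈xs , s , fa≡b) with solved a∈xs s
      ... | (step i p , fa≡δ , _) , _ = record
        { Pruned v ; depth≤ = ≤-trans (depth≤ v) (≤-maxᶠ (nodeDepth U ∘ t) i) }
        where
        descend : ∀ {a} → a ∈ xs → S′ b a → SolvesAt z (t i) a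
        descend a∈xs (s , fa≡b′) with solved a∈xs s
        ... | (step j q , fa≡δj , a∈q) , label
          -- Edge labels are distinct, so all objects with the answer `b` follow the edge `i` taken
          -- by the chosen one.
          with δ-injective (trans (sym fa≡δj) (trans fa≡b′ (trans (sym fa≡b) fa≡δ)))
        ... | refl = (q , a∈q) , λ p a∈p → label (step i p) (fa≡δj , a∈p)

        v = prune (t i) (det i) (ov i) (a , a∈xs , s , fa≡b) descend

      choose : Dec (Occupied (S′ false)) → Dec (Occupied (S′ true)) → Pruned _ S
      choose (yes o₀) (yes o₁) = branch f f∈z λ where
        false → side false o₀
        true  → side true o₁
      choose (yes o₀) (no ¬o₁) = restrict f all-false (side false o₀)
        where
        all-false : ∀ {a} → a ∈ xs → S a → proj₁ f a ≡ false
        all-false {a} a∈xs s with proj₁ f a in fa≡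
        ... | false = refl
        ... | true  = ⊥-elim (¬o₁ (a , a∈xs , s , fa≡))
      choose (no ¬o₀) (yes o₁) = restrict f all-true (side true o₁)
        where
        all-true : ∀ {a} → a ∈ xs → S a → proj₁ f a ≡ true
        all-true {a} a∈xs s with proj₁ f a in fa≡
        ... | false = ⊥-elim (¬o₀ (a , a∈xs , s , fa≡))
        ... | true  = refl
      choose (no ¬o₀) (no ¬o₁) with proj₁ f a in fa≡
      ... | false = ⊥-elim (¬o₀ (a , a∈xs , s , fa≡))
      ... | true  = ⊥-elim (¬o₁ (a , a∈xs , s , fa≡))

  -- Lower bound for nondeterministic trees.

  module Lower (xs : List Object) where

    -- For a node with s nodes below and including it, and of depth d: n counts
    -- the listed objects that reach the node, c those that also reach a leaf
    -- from it.
    Dichotomy : (c n s d : ℕ) → Set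
    Dichotomy c n s d = 2 * c ≤ s ⊎ (2 * n ≤ suc s × n ≤ 2 ^ d)

    -- All siblings are reached by the same `S`. The second case of the dichotomy speaks of `S`
    -- only, so it passes from one sibling to the whole family, as further siblings only increase
    -- size and depth. If every sibling is in the first case, the bounds add up over the union of
    -- the covered sets.
    alternatives : ∀ {k} (s d : Fin k → ℕ) (S : Pred Object ℓ) (C : Fin k → Pred Object ℓ) →
      (∀ i → Dichotomy (count (S ∩ C i) xs) (count S xs) (s i) (d i)) →
      Dichotomy (count (S ∩ λ a → ∃[ i ] C i a) xs) (count S xs) (sumᶠ s) (maxᶠ d)
    alternatives {zero} s d S C each =
      inj₁ (≤-reflexive (cong (2 *_) (count-none xs (All.universal (λ { _ (_ , () , _) }) xs))))
    alternatives {suc k} s d S C each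
      with each zero | alternatives (s ∘ suc) (d ∘ suc) S (C ∘ suc) (each ∘ suc)
    ... | inj₂ (2n≤ , n≤) | _ = inj₂
      ( ≤-trans 2n≤ (s≤s (m≤m+n (s zero) _))
      , ≤-trans n≤ (^-monoʳ-≤ 2 (m≤m⊔n (d zero) _)))
    ... | inj₁ _ | inj₂ (2n≤ , n≤) = inj₂
      ( ≤-trans 2n≤ (s≤s (m≤n+m _ (s zero)))
      , ≤-trans n≤ (^-monoʳ-≤ 2 (m≤n⊔m (d zero) _)))
    ... | inj₁ 2c≤ | inj₁ 2c′≤ = inj₁ (begin
      2 * count _ xs                  ≤⟨ *-monoʳ-≤ 2 (count-⊎ split xs) ⟩
      2 * (count _ xs + count _ xs)   ≡⟨ *-distribˡ-+ 2 (count _ xs) _ ⟩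
      2 * count _ xs + 2 * count _ xs ≤⟨ +-mono-≤ 2c≤ 2c′≤ ⟩
      s zero + sumᶠ (s ∘ suc)         ∎)
      where
      open ≤-Reasoning
      split : ∀ a → (S ∩ λ a → ∃[ i ] C i a) a →
        (S ∩ C zero) a ⊎ (S ∩ λ a → ∃[ i ] C (suc i) a) a
      split a (s , zero  , c) = inj₁ (s , c)
      split a (s , suc i , c) = inj₂ (s , i , c)

    Covered : Node U → Pred Object ℓ
    Covered v a = ∃[ p ] pathObjects U {v} p a

    module _ (z : Problem U)
             (distinct : AllPairs (λ a b → solution z a ≢ solution z b) xs) where

      -- Induction on the tree. A terminal node gives all of `S` one label, so at most one listed
      -- object reaches it. At a working node the edges are grouped by label, and each group is a
      -- family of alternatives for the objects giving that answer.
      node-dichotomy : ∀ v (S : Pred Object ℓ) →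
        (∀ a → S a → ∀ p → pathObjects U {v} p a → pathLabel U p ≡ solution z a) →
        Dichotomy (count (S ∩ Covered v) xs) (count S xs) (nodeSize U v) (nodeDepth U v)
      node-dichotomy (terminal r) S label = inj₂ (*-monoʳ-≤ 2 one , one)
        where
        one : count S xs ≤ 1
        one = count-constant (solution z) (λ a s → sym (label a s stop tt)) distinct
      node-dichotomy (working f k δ t) S label = combine (side false) (side true)
        where
        S′ : Bool → Pred Object ℓ
        S′ b a = S a × proj₁ f a ≡ b

        C : Bool → Fin (suc k) → Pred Object ℓ
        C b i a = δ i ≡ b × Covered (t i) a

        c : Bool → ℕ
        c b = count (S′ b ∩ λ a → ∃[ i ] C b i a) xs

        w : Bool → ℕ
        w b = sumᶠ (labelled δ b (nodeSize U ∘ t))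

        D : ℕ
        D = maxᶠ (nodeDepth U ∘ t)

        w-sum : w false + w true ≡ sumᶠ (nodeSize U ∘ t)
        w-sum = labelled-sum δ (nodeSize U ∘ t)

        each : ∀ b i → Dichotomy (count (S′ b ∩ C b i) xs) (count (S′ b) xs)
                         (labelled δ b (nodeSize U ∘ t) i) (nodeDepth U (t i))
        each b i with δ i ≟ b
        -- An edge with the other label has weight 0 and covers nothing on this side.
        ... | no δ≢b = inj₁ (≤-reflexive (cong (2 *_)
          (count-none xs (All.universal (λ { _ (_ , δ≡b , _) → δ≢b δ≡b }) xs))))
        ... | yes refl with node-dichotomy (t i) (S′ (δ i))
                              (λ a (s , fa≡δ) p a∈p → label a s (step i p) (fa≡δ , a∈p))
        ...   | inj₁ 2c≤ = inj₁
          (≤-trans (*-monoʳ-≤ 2 (count-mono (λ _ (s , _ , cov) → s , cov) xs)) 2c≤)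
        ...   | inj₂ tight = inj₂ tight

        side : ∀ b → Dichotomy (c b) (count (S′ b) xs) (w b) D
        side b = alternatives (labelled δ b (nodeSize U ∘ t)) (nodeDepth U ∘ t)
                   (S′ b) (C b) (each b)

        covered-split : count (S ∩ Covered (working f k δ t)) xs ≤ c false + c true
        covered-split = count-⊎ split xs
          where
          split : ∀ a → (S ∩ Covered (working f k δ t)) a →
            (S′ false ∩ λ a → ∃[ i ] C false i a) a ⊎ (S′ true ∩ λ a → ∃[ i ] C true i a) a
          split a (s , step i p , fa≡δ , a∈p) with δ i in δi≡
          ... | false = inj₁ ((s , fa≡δ) , i , δi≡ , p , a∈p)
          ... | true  = inj₂ ((s , fa≡δ) , i , δi≡ , p , a∈p)

        S-split : count S xs ≤ count (S′ false) xs + count (S′ true) xs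
        S-split = count-⊎ split xs
          where
          split : ∀ a → S a → S′ false a ⊎ S′ true a
          split a s with proj₁ f a
          ... | false = inj₁ (s , refl)
          ... | true  = inj₂ (s , refl)

        doubled : ∀ n₀ n₁ {n m₀ m₁} → n ≤ n₀ + n₁ → 2 * n₀ ≤ m₀ → 2 * n₁ ≤ m₁ → 2 * n ≤ m₀ + m₁
        doubled n₀ n₁ n≤ 2n₀≤ 2n₁≤ = ≤-trans (*-monoʳ-≤ 2 n≤)
          (≤-trans (≤-reflexive (*-distribˡ-+ 2 n₀ n₁)) (+-mono-≤ 2n₀≤ 2n₁≤))

        -- A side is at most one node short of twice its covered objects. The working node itself
        -- makes up for one such deficit, so the first case is lost only if both sides are in the
        -- second.
        slack : ∀ b → Dichotomy (c b) (count (S′ b) xs) (w b) D → 2 * c b ≤ suc (w b)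
        slack b (inj₁ 2c≤)       = ≤-trans 2c≤ (n≤1+n _)
        slack b (inj₂ (2n≤ , _)) = ≤-trans (*-monoʳ-≤ 2 (count-mono (λ _ → proj₁) xs)) 2n≤

        combine : Dichotomy (c false) (count (S′ false) xs) (w false) D →
                  Dichotomy (c true) (count (S′ true) xs) (w true) D →
                  Dichotomy (count (S ∩ Covered (working f k δ t)) xs) (count S xs)
                            (suc (sumᶠ (nodeSize U ∘ t))) (suc D)
        combine (inj₂ (2n₀≤ , n₀≤)) (inj₂ (2n₁≤ , n₁≤)) = inj₂
          ( ≤-trans (doubled (count (S′ false) xs) (count (S′ true) xs) S-split 2n₀≤ 2n₁≤)
              (≤-reflexive (cong suc (trans (+-suc (w false) _) (cong suc w-sum))))
          , ≤-trans S-split (+-mono-≤ n₀≤ (≤-trans n₁≤ (≤-reflexive (sym (+-identityʳ _))))))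
        combine (inj₁ 2c₀≤) r = inj₁
          (≤-trans (doubled (c false) (c true) covered-split 2c₀≤ (slack true r))
            (≤-reflexive (trans (+-suc (w false) _) (cong suc w-sum))))
        combine l@(inj₂ _) (inj₁ 2c₁≤) = inj₁
          (≤-trans (doubled (c false) (c true) covered-split (slack false l) 2c₁≤)
            (≤-reflexive (cong suc w-sum)))

      -- Every object is covered below the root, so covered and reaching objects have the same
      -- count. The root adds one node, which makes the first bound strict; a tree of size exactly
      -- twice the count must then satisfy the depth bound.
      tree-dichotomy : ∀ Γ → SolvesNondeterministically U Γ z →
        2 * count Everything xs < size U Γ ⊎
        (2 * count Everything xs ≤ size U Γ × count Everything xs ≤ 2 ^ depth U Γ)
      tree-dichotomy (root k t) (cover , label)
        with alternatives (nodeSize U ∘ t) (nodeDepth U ∘ t) Everything (Covered ∘ t)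
               (λ i → node-dichotomy (t i) Everything (λ a _ p → label a (i , p)))
      ... | inj₂ tight = inj₂ tight
      ... | inj₁ 2c≤   = inj₁ (s≤s (≤-trans (*-monoʳ-≤ 2 (count-mono all-covered xs)) 2c≤))
        where
        all-covered : ∀ a → ⊤ → (Everything ∩ λ a → ∃[ i ] Covered (t i) a) a
        all-covered a _ with cover a
        ... | (i , p) , a∈p = tt , i , p , a∈p

  -- Problems with injective decisions, and worst-case costs.

  hardest : Problem U → Problem U
  -- Decisions must be positive, hence the successor. The attributes stay, and with them the
  -- dimension and the realized tuples.
  hardest z = record z { ν = λ v → suc (binary v) , [ _ ] }

  hardest-distinct : ∀ z {xs} → Separated z xs →
    AllPairs (λ a b → solution (hardest z) a ≢ solution (hardest z) b) xs
  hardest-distinct z = AllPairs.map λ tuple≢ eq →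
    tuple≢ (binary-injective _ _ (suc-injective (cong value eq)))

  hardest-dichotomy : ∀ z Γ → SolvesNondeterministically U Γ (hardest z) →
    2 * N z < size U Γ ⊎ (2 * N z ≤ size U Γ × N z ≤ 2 ^ depth U Γ)
  hardest-dichotomy z =
    Lower.tree-dichotomy (realized z) (hardest z) (hardest-distinct z (realized-separated z))

  nondeterministic : ∀ κ Γ z → Solves U κ Γ z → SolvesNondeterministically U Γ z
  nondeterministic ld Γ z = proj₂
  nondeterministic la Γ z = id

  minimum≤worst : ∀ μ κ (n : ℕ⁺) {w} → IsMaximum (WorstCost U em μ κ n) w →
    ∀ z → value (dim z) ≤ value n → proj₁ (minimumCost U em μ κ z) ≤ w
  minimum≤worst μ κ n (_ , above) z dim≤n = above _ (z , dim≤n , refl)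

  worst-mono : ∀ μ κ {m n : ℕ⁺} {v w} → IsMaximum (WorstCost U em μ κ m) v →
    IsMaximum (WorstCost U em μ κ n) w → value m ≤ value n → v ≤ w
  worst-mono μ κ {n = n} ((z , dim≤m , refl) , _) max m≤n =
    minimum≤worst μ κ n max z (≤-trans dim≤m m≤n)

  h-mono : ∀ κ {m n : ℕ⁺} → value m ≤ value n → h U em κ m ≤ h U em κ n
  h-mono κ {m} {n} =
    worst-mono (depth U) κ {m} {n} (proj₂ (worstDepth U em κ m)) (proj₂ (worstDepth U em κ n))

  L-mono : ∀ κ {m n : ℕ⁺} → value m ≤ value n → L U em κ m ≤ L U em κ n
  L-mono κ {m} {n} =
    worst-mono (size U) κ {m} {n} (proj₂ (worstSize U em κ m)) (proj₂ (worstSize U em κ n))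

  shallow : ∀ κ z →
    ∃[ Γ ] (_Over_ U Γ z × Solves U κ Γ z × depth U Γ ≤ h U em κ (dim z))
  shallow κ z with minimumCost U em (depth U) κ z
                 | minimum≤worst (depth U) κ (dim z) (proj₂ (worstDepth U em κ (dim z))) z ≤-refl
  ... | _ , (Γ , over , solves , refl) , _ | ≤h = Γ , over , solves , ≤h

  -- Both cases of the dichotomy give this size for a smallest tree solving `hardest z`, which has
  -- the dimension of `z`.
  2N≤L : ∀ κ z → 2 * N z ≤ L U em κ (dim z)
  2N≤L κ z with minimumCost U em (size U) κ (hardest z)
              | minimum≤worst (size U) κ (dim z) (proj₂ (worstSize U em κ (dim z)))
                  (hardest z) ≤-refl
  ... | _ , (Γ , _ , solves , refl) , _ | ≤L
    with hardest-dichotomy z Γ (nondeterministic κ Γ (hardest z) solves)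
  ... | inj₁ 2N<       = ≤-trans (≤-trans (n≤1+n _) 2N<) ≤L
  ... | inj₂ (2N≤ , _) = ≤-trans 2N≤ ≤L

  -- Whole trees: pruning, and bundling of paths.

  someObject : Object
  someObject with em {Object}
  ... | yes a = a
  ... | no ¬a = ⊥-elim (objects-infinite ([] , λ a → ⊥-elim (¬a a)))

  -- Pruning is done relative to one representative of each tuple; `solvesAt-≡` carries correctness
  -- over to all objects. The successor in `size<` accounts for the root.
  prune-tree : ∀ z Γ → _Over_ U Γ z → SolvesDeterministically U Γ z →
    ∃[ Γ′ ] (_Over_ U Γ′ z × SolvesDeterministically U Γ′ z ×
             depth U Γ′ ≤ depth U Γ × size U Γ′ ≤ 2 * N z)
  prune-tree z (root zero t) over ((_ , det) , cover , label) =
    root 0 (λ _ → node) , (λ _ → over′) ,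
    ((refl , λ _ → deterministic) ,
     (λ a → let (p , a∈p) , _ = solves′ a in (zero , p) , a∈p) ,
     (λ a (_ , p) → proj₂ (solves′ a) p)) ,
    ⊔-mono-≤ depth≤ ≤-refl ,
    ≤-trans (≤-reflexive (cong suc (+-identityʳ _))) size<
    where
    open Pruning z (realized z)

    solved : ∀ {a} → SolvesAt z (t zero) a
    solved {a} with cover a
    ... | (zero , p) , a∈p = (p , a∈p) , λ q → label a (zero , q)

    occupied : Occupied Everything
    occupied with find (realized-complete z someObject)
    ... | a , a∈reps , _ = a , a∈reps , tt

    open Pruned (prune (t zero) (det zero) (over zero) occupied (λ _ _ → solved))
      renaming (over to over′)

    solves′ : ∀ a → SolvesAt z node a
    solves′ a with find (realized-complete z a)
    ... | b , b∈reps , eq = solvesAt-≡ z over′ eq (solves b∈reps tt)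

  -- The path as a tree of its own: each working node keeps only the edge that the path takes, and
  -- an object answering differently has no path through it.
  chain : ∀ {v} → Path U v → Node U
  chain (stop {r})               = terminal r
  chain (step {f} {δ = δ} i p) = working f 0 (λ _ → δ i) (λ _ → chain p)

  chain-over : ∀ z {v} (p : Path U v) → NodeOver U z v → NodeOver U z (chain p)
  chain-over z stop       _           = tt
  chain-over z (step i p) (f∈z , over) = f∈z , λ _ → chain-over z p (over i)

  chain-depth : ∀ {v} (p : Path U v) → nodeDepth U (chain p) ≡ pathLength U p
  chain-depth stop       = refl
  chain-depth (step i p) = cong suc (trans (⊔-identityʳ _) (chain-depth p))

  chain-size : ∀ {v} (p : Path U v) → nodeSize U (chain p) ≡ suc (pathLength U p)
  chain-size stop       = refl
  chain-size (step i p) = cong suc (trans (+-identityʳ _) (chain-size p))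

  chain-path : ∀ {v} (p : Path U v) {a} → pathObjects U p a →
    ∃[ q ] pathObjects U {chain p} q a
  chain-path stop       _            = stop , tt
  chain-path (step i p) (fa≡ , a∈p) = let q , a∈q = chain-path p a∈p in
    step zero q , fa≡ , a∈q

  chain-objects : ∀ {v} (p : Path U v) q {a} → pathObjects U {chain p} q a → pathObjects U p a
  chain-objects stop       stop          _            = tt
  chain-objects (step i p) (step zero q) (fa≡ , a∈q) = fa≡ , chain-objects p q a∈q

  chain-label : ∀ {v} (p : Path U v) (q : Path U (chain p)) → pathLabel U q ≡ pathLabel U p
  chain-label stop       stop          = refl
  chain-label (step i p) (step zero q) = chain-label p q

  -- One accepting path of `Γ` is kept for each representative. An object can follow the chain of
  -- the representative sharing its tuple, and labels stay correct because a chain accepts only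
  -- objects that its path in `Γ` accepts.
  bundle : ∀ z Γ → _Over_ U Γ z → SolvesNondeterministically U Γ z →
    ∃[ Γ′ ] (_Over_ U Γ′ z × SolvesNondeterministically U Γ′ z ×
             depth U Γ′ ≤ depth U Γ × size U Γ′ ≤ suc (N z * suc (depth U Γ)))
  bundle z Γ@(root _ t) over (cover , label) =
    go (realized z) (realized-complete z) (length≤count (realized z))
    where
    path : ∀ a → CompletePath U Γ
    path a = proj₁ (cover a)

    branchOf : Object → Node U
    branchOf a = chain (proj₂ (path a))

    short : ∀ a → pathLength U (proj₂ (path a)) ≤ depth U Γ
    short a = proj₂ (depth-isMaximum U Γ) _ (path a , refl)

    go : ∀ xs → (∀ a → Any (λ b → tuple z a ≡ tuple z b) xs) → length xs ≤ N z →
      ∃[ Γ′ ] (_Over_ U Γ′ z × SolvesNondeterministically U Γ′ z ×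
               depth U Γ′ ≤ depth U Γ × size U Γ′ ≤ suc (N z * suc (depth U Γ)))
    -- A root needs at least one edge; the existence of an object excludes the empty list.
    go [] complete _ with complete someObject
    ... | ()
    go xs@(_ ∷ ys) complete length≤N =
      root (length ys) (branchOf ∘ lookup xs) ,
      (λ i → chain-over z _ (over _)) ,
      (cover′ ,
       λ a (i , q) a∈q → trans (chain-label (proj₂ (path (lookup xs i))) q)
         (label a (path (lookup xs i)) (chain-objects (proj₂ (path (lookup xs i))) q a∈q))) ,
      maxᶠ-lub (nodeDepth U ∘ branchOf ∘ lookup xs)
        (λ i → ≤-trans (≤-reflexive (chain-depth (proj₂ (path (lookup xs i))))) (short _)) ,
      s≤s (≤-trans
        (sumᶠ-≤ (nodeSize U ∘ branchOf ∘ lookup xs)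
          (λ i → ≤-trans (≤-reflexive (chain-size (proj₂ (path (lookup xs i))))) (s≤s (short _))))
        (*-monoˡ-≤ _ length≤N))
      where
      cover′ : ∀ a → ∃[ ξ ] objects U (root (length ys) (branchOf ∘ lookup xs)) ξ a
      cover′ a = (i , proj₁ q) , proj₂ q
        where
        i = Any.index (complete a)
        b = lookup xs i
        q = chain-path (proj₂ (path b))
              (pathObjects-≡ z (over _) (sym (lookup-index (complete a)))
                (proj₂ (path b)) (proj₂ (cover b)))

  -- Reachability and the boundary pair.

  ld-reachable : Reachable U em ld
  ld-reachable z with shallow ld z
  ... | Γ , over , solves , depth≤h with prune-tree z Γ over solves
  ... | Γ′ , over′ , solves′ , depth≤ , size≤ =
    Γ′ , over′ , solves′ , ≤-trans depth≤ depth≤h , ≤-trans size≤ (2N≤L ld z)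

  module _ (c n₀ : ℕ) (h≤c : ∀ n → n₀ ≤ value n → h U em la n ≤ c) where

    -- Monotonicity extends the eventual bound to small `n`, through a dimension above both `n` and
    -- `n₀`.
    h-bounded : ∀ n → h U em la n ≤ c
    h-bounded n = ≤-trans (h-mono la {n} {n′} (≤-trans (m≤m+n (value n) n₀) (n≤1+n _)))
                          (h≤c n′ (≤-trans (m≤n+m n₀ (value n)) (n≤1+n _)))
      where
      n′ : ℕ⁺
      n′ = suc (value n + n₀) , [ _ ]

    -- An odd depth bound makes the halving exact.
    m : ℕ⁺
    m = suc (2 * c) , [ _ ]

    m-even : ∀ l → (value m + 1) * l ≡ l * suc c * 2
    m-even l = solve 2
      (λ c l → (con 1 :+ con 2 :* c :+ con 1) :* l := l :* (con 1 :+ c) :* con 2) refl c l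
      where open +-*-Solver

    -- Bundling a tree of depth at most `m` takes at most N(m + 1) nodes besides the root, and N is
    -- at most half of `L`.
    bounded-la-pair : BoundaryPair U la (λ _ → value m)
                        (λ n → (value m + 1) * L U em la n / 2 + 1)
    bounded-la-pair z with shallow la z
    ... | Γ , over , solves , depth≤h with bundle z Γ over solves
    ... | Γ′ , over′ , solves′ , depth≤ , size≤ =
      Γ′ , over′ , solves′ , ≤-trans depth≤ Γ≤m , (begin
        size U Γ′                        ≤⟨ size≤ ⟩
        suc (N z * suc (depth U Γ))      ≤⟨ s≤s (*-monoʳ-≤ (N z) (s≤s Γ≤m)) ⟩
        suc (N z * suc (value m))        ≡⟨ cong suc (double (N z) c) ⟩
        suc (2 * N z * suc c)            ≤⟨ s≤s (*-monoˡ-≤ (suc c) (2N≤L la z)) ⟩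
        suc (l * suc c)                  ≡⟨ cong suc (m*n/n≡m (l * suc c) 2) ⟨
        suc (l * suc c * 2 / 2)          ≡⟨ cong (λ x → suc (x / 2)) (m-even l) ⟨
        suc ((value m + 1) * l / 2)      ≡⟨ +-comm 1 _ ⟩
        (value m + 1) * l / 2 + 1        ∎)
      where
      open ≤-Reasoning
      l = L U em la (dim z)

      Γ≤m : depth U Γ ≤ value m
      Γ≤m = ≤-trans depth≤h (≤-trans (h-bounded (dim z)) (≤-trans (m≤m+n c _) (n≤1+n _)))

      double : ∀ n c → n * suc (suc (2 * c)) ≡ 2 * n * suc c
      double = solve 2 (λ n c → n :* (con 2 :+ con 2 :* c) := con 2 :* n :* (con 1 :+ c)) refl
        where open +-*-Solver

    -- Let `z` attain the worst size for `n`. A tree for `hardest z` within both bounds has at most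
    -- 2N nodes, which rules out the strict case, so N is at most 2 to the power `c`. Yet the lower
    -- bound on `L` makes N at least n + 1.
    not-la-reachable : (∀ n → 2 * (value n + 1) ≤ L U em la n) → ¬ Reachable U em la
    not-la-reachable lower reachable = contradiction (proj₂ (worstSize U em la n))
      where
      n : ℕ⁺
      -- Chosen to exceed the number of tuples that depth `c` allows.
      n = suc (2 ^ c) , [ _ ]

      contradiction : ¬ IsMaximum (WorstCost U em (size U) la n) (L U em la n)
      contradiction ((z , dim≤n , min≡L) , _) = case hardest-dichotomy z Γ solves of λ where
          (inj₁ 2N<size)   → <⇒≱ 2N<size
            (≤-trans size≤ (≤-trans (L-mono la {dim z} {n} dim≤n) L≤2N))
          (inj₂ (_ , N≤)) → <⇒≱
            (s≤s (≤-trans N≤ (^-monoʳ-≤ 2 (≤-trans depth≤ (h-bounded (dim z))))))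
            (≤-trans (m≤m+n (value n) 1) (*-cancelˡ-≤ 2 (≤-trans (lower n) L≤2N)))
        where
        -- A deterministic solution is also a nondeterministic one, so a pruned deterministic tree
        -- for `z` bounds its least nondeterministic size.
        L≤2N : L U em la n ≤ 2 * N z
        L≤2N with cost-exists U (size U) ld z
        ... | _ , Γ₀ , over₀ , solves₀ , _ with prune-tree z Γ₀ over₀ solves₀
        ... | Γ₁ , over₁ , (_ , solves₁) , _ , size≤ =
          ≤-trans (≤-reflexive (sym min≡L))
            (≤-trans (proj₂ (proj₂ (minimumCost U em (size U) la z)) _
                        (Γ₁ , over₁ , solves₁ , refl))
                     size≤)

        tree = reachable (hardest z)
        Γ = proj₁ tree

        solves : SolvesNondeterministically U Γ (hardest z)
        solves = proj₁ (proj₂ (proj₂ tree))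

        depth≤ : depth U Γ ≤ h U em la (dim z)
        depth≤ = proj₁ (proj₂ (proj₂ (proj₂ tree)))

        size≤ : size U Γ ≤ L U em la (dim z)
        size≤ = proj₂ (proj₂ (proj₂ (proj₂ tree)))

theorem2 : ∀ {ℓ} (em : ExcludedMiddle ℓ) (U : InfiniteBinaryInformationSystem ℓ) →
    W₁ˡ U em →
    Reachable U em ld ×
    (¬ Reachable U em la ×
    Σ[ m ∈ ℕ⁺ ] ((∀ n → 2 ∣ (value m + 1) * L U em la n) ×
    BoundaryPair U la (λ _ → value m)
    (λ n → (value m + 1) * L U em la n / 2 + 1)))
theorem2 em U w =
  ld-reachable em U ,
  not-la-reachable em U c n₀ h≤c (W₁ˡ.L-lower w la) ,
  m em U c n₀ h≤c ,
  (λ n → divides (L U em la n * suc c) (m-even em U c n₀ h≤c (L U em la n))) ,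
  bounded-la-pair em U c n₀ h≤c
  where
  c = proj₁ (W₁ˡ.h-la w)
  n₀ = proj₁ (proj₂ (W₁ˡ.h-la w))
  h≤c : ∀ n → n₀ ≤ value n → h U em la n ≤ c
  h≤c n n₀≤n = ≤-trans (proj₂ (proj₂ (W₁ˡ.h-la w)) n n₀≤n) (≤-reflexive (*-identityʳ c))
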